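{- Let $G$ be a finite abelian group whose exponent $n\geq 2$ is odd, written as $G=H\oplus C_n^r$ with $\exp(H)<n$, and let $A=[1,n-1]=\{1,\ldots,n-1\}$. Let $S$ be a finite sequence over $G$ such that $0$ does not occur in $S$, every term of $S$ has order $n$, and $N_{A,0}(S)=2^{|S|-D_A(G)+1}$. Then $r\leq |S|\leq 2r$, and there is a maximal $A$-weighted zero-sum free subsequence $T=\prod_{i=1}^r g_i$ of $S$ such that $$S=\prod_{i=1}^{r}g_i\prod_{j=1}^{k}h_j,$$ where $k\in[0,r]$ (for $k=0$ this means $S=\prod_{i=1}^r g_i$), and there exist pairwise disjoint subsets $I_1,\ldots,I_k\subseteq[1,r]$ such that for each $j\in[1,k]$ there are $b_j\in A$ and coefficients $a_i^{(j)}\in A$ ($i\in I_j$) with $$b_jh_j=\sum_{i\in I_j}a_i^{(j)}g_i.$$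
   Context: $G$ is written additively; $C_n$ is the cyclic group of order $n$. The decomposition is $G=H\oplus C_n^r$ with $H=C_{n_1}\oplus\cdots\oplus C_{n_t}$ (possibly trivial), $1<n_1\mid n_2\mid\cdots\mid n_t\mid n=\exp(G)$ and $n_t<n$. For integers $a,b\ge 0$, $[a,b]$ denotes the set of non-negative integers $x$ with $a\le x\le b$. A sequence over $G$ is a finite sequence $S=\prod_{i=1}^m g_i$ of elements of $G$ (repetition allowed, order irrelevant); $|S|=m$ is its length. Subsequences are identified by their index sets $I\subseteq[1,m]$. $N_{A,0}(S)$ is the number of index sets $I\subseteq [1,m]$ (including $I=\emptyset$, whose sum is by convention $0$) for which there exist $a_i\in A$ ($i\in I$) with $\sum_{i\in I}a_ig_i=0$. The $A$-weighted Davenport constant $D_A(G)$ is the smallest positive integer $l$ such that for every sequence $g_1\cdots g_t$ over $G$ of length $t\ge l$ there are a nonempty $I\subseteq[1,t]$ and $a_i\in A$ ($i\in I$) with $\sum_{i\in I}a_ig_i=0$. A sequence $g_1\cdots g_m$ is $A$-weighted zero-sum free if there are no nonempty $I\subseteq[1,m]$ and $a_i\in A$ ($i\in I$) with $\sum_{i\in I}a_ig_i=0$. A subsequence $T$ of $S$ is a maximal $A$-weighted zero-sum free subsequence if it is $A$-weighted zero-sum free and has maximal length among the $A$-weighted zero-sum free subsequences of $S$. -}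

module Defs where

open import Algebra.Bundles using (AbelianGroup)
import Algebra.Construct.DirectProduct as DirectProduct
import Algebra.Construct.Terminal as Terminal
import Algebra.Definitions.RawMonoid as RawMonoidDefinitions
open import Algebra.Morphism.Structures using (module GroupMorphisms)
open import Data.Bool.Base using (if_then_else_)
open import Data.Fin.Base using (Fin; _↑ˡ_; _↑ʳ_)
open import Data.Fin.Permutation using (Permutation; _⟨$⟩ʳ_)
open import Data.Fin.Subset
  using (Subset; Nonempty; Empty; _∩_; ∣_∣; _⊆_) renaming (_∈_ to _∈ₛ_; _∉_ to _∉ₛ_)
open import Data.Integer.Base as ℤ using (ℤ; +_)
import Data.Integer.Properties as ℤ
import Data.Integer.Divisibility.Signed as ℤ
open import Data.Integer.Tactic.RingSolver using (solve-∀)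
open import Data.List.Base using (List; []; _∷_; length)
open import Data.List.Membership.Propositional using (_∈_)
open import Data.List.Relation.Unary.Unique.Propositional using (Unique)
open import Data.Nat.Base using (ℕ; _+_; _≤_)
open import Data.Product.Base using (∃; ∃-syntax; Σ-syntax; _×_; _,_)
open import Data.Vec.Base using (lookup)
open import Data.Vec.Functional using (Vector)
open import Function.Bundles using (_⇔_)
open import Level using (Level; 0ℓ; _⊔_)
open import Relation.Binary.PropositionalEquality
  using (_≡_; _≢_; refl; subst)
open import Relation.Nullary using (¬_)
open import Relation.Unary using (Pred)

private
  variable
    a c c′ ℓ ℓ′ : Level

[_,_] : ℕ → ℕ → Pred ℕ 0ℓ
[ a , b ] x = a ≤ x × x ≤ b

IsLeastPositive : Pred ℕ ℓ → Pred ℕ ℓ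
IsLeastPositive P k = 1 ≤ k × P k × (∀ j → 1 ≤ j → P j → k ≤ j)

-- P has exactly k elements.
HasCardinality : {X : Set a} → Pred X ℓ → ℕ → Set (a ⊔ ℓ)
HasCardinality {X = X} P k =
  Σ[ xs ∈ List X ] Unique xs × (∀ x → x ∈ xs ⇔ P x) × length xs ≡ k

------------------------------------------------------------------------
-- Cyclic groups and direct sums

-- C k is ℤ with equality taken to be congruence modulo k.
C : ℕ → AbelianGroup 0ℓ 0ℓ
C k = record
  { Carrier = ℤ
  ; _≈_     = _≈_
  ; _∙_     = ℤ._+_
  ; ε       = + 0
  ; _⁻¹     = ℤ.-_
  ; isAbelianGroup = record
    { isGroup = record
      { isMonoid = record
        { isSemigroup = record
          { isMagma = record
            { isEquivalence = record
              { refl  = λ {x} → ≡⇒≈ {x} refl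
              ; sym   = λ {x} {y} p →
                  subst (+ k ℤ.∣_) (sym-eq x y) (ℤ.∣m⇒∣-m p)
              ; trans = λ {x} {y} {z} p q →
                  subst (+ k ℤ.∣_) (trans-eq x y z) (ℤ.∣m∣n⇒∣m+n p q)
              }
            ; ∙-cong = λ {x} {y} {u} {v} p q →
                subst (+ k ℤ.∣_) (cong-eq x y u v) (ℤ.∣m∣n⇒∣m+n p q)
            }
          ; assoc = λ x y z → ≡⇒≈ (ℤ.+-assoc x y z)
          }
        ; identity = (λ x → ≡⇒≈ (ℤ.+-identityˡ x)) , (λ x → ≡⇒≈ (ℤ.+-identityʳ x))
        }
      ; inverse = (λ x → ≡⇒≈ (ℤ.+-inverseˡ x)) , (λ x → ≡⇒≈ (ℤ.+-inverseʳ x))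
      ; ⁻¹-cong = λ {x} {y} p →
          subst (+ k ℤ.∣_) (neg-eq x y) (ℤ.∣m⇒∣-m p)
      }
    ; comm = λ x y → ≡⇒≈ (ℤ.+-comm x y)
    }
  }
  where
  _≈_ : ℤ → ℤ → Set
  x ≈ y = + k ℤ.∣ (x ℤ.- y)

  ≡⇒≈ : ∀ {x y} → x ≡ y → x ≈ y
  ≡⇒≈ {x} refl = ℤ.divides (+ 0) (ℤ.+-inverseʳ x)

  sym-eq : ∀ x y → ℤ.- (x ℤ.- y) ≡ y ℤ.- x
  sym-eq = solve-∀

  trans-eq : ∀ x y z → (x ℤ.- y) ℤ.+ (y ℤ.- z) ≡ x ℤ.- z
  trans-eq = solve-∀

  cong-eq : ∀ x y u v → (x ℤ.- y) ℤ.+ (u ℤ.- v) ≡ (x ℤ.+ u) ℤ.- (y ℤ.+ v)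
  cong-eq = solve-∀

  neg-eq : ∀ x y → ℤ.- (x ℤ.- y) ≡ (ℤ.- x) ℤ.- (ℤ.- y)
  neg-eq = solve-∀

infixr 6 _⊕_
_⊕_ : AbelianGroup c ℓ → AbelianGroup c′ ℓ′ → AbelianGroup (c ⊔ c′) (ℓ ⊔ ℓ′)
_⊕_ = DirectProduct.abelianGroup

⨁C : List ℕ → AbelianGroup 0ℓ 0ℓ
⨁C []       = Terminal.abelianGroup
⨁C (k ∷ ks) = C k ⊕ ⨁C ks

infix 4 _≅_
_≅_ : AbelianGroup c ℓ → AbelianGroup c′ ℓ′ → Set (c ⊔ ℓ ⊔ c′ ⊔ ℓ′)
G ≅ H = ∃ IsGroupIsomorphism
  where
  module G = AbelianGroup G
  module H = AbelianGroup H
  open GroupMorphisms G.rawGroup H.rawGroup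

------------------------------------------------------------------------
-- Orders and weighted zero-sums in an abelian group

module _ (G : AbelianGroup c ℓ) where
  open AbelianGroup G using (Carrier; _≈_; ε; rawMonoid)
  open RawMonoidDefinitions rawMonoid using (sum) renaming (_×_ to _·_)

  IsOrder : Carrier → Pred ℕ ℓ
  IsOrder g = IsLeastPositive (λ k → k · g ≈ ε)

  IsExponent : Pred ℕ (c ⊔ ℓ)
  IsExponent = IsLeastPositive (λ k → ∀ g → k · g ≈ ε)

  -- ∑_{i ∈ I} aᵢ gᵢ; the values of a outside I are irrelevant.
  weightedSum : ∀ {m} → Vector Carrier m → Subset m → (Fin m → ℕ) → Carrier
  weightedSum g I a = sum (λ i → if lookup I i then a i · g i else ε)

  module _ (A : Pred ℕ 0ℓ) where

    Weights : ∀ {m} → Subset m → Pred (Fin m → ℕ) 0ℓ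
    Weights I a = ∀ i → i ∈ₛ I → A (a i)

    ZeroSum : ∀ {m} → Vector Carrier m → Pred (Subset m) ℓ
    ZeroSum S I = ∃[ a ] Weights I a × weightedSum S I a ≈ ε

    -- N_{A,0}(S) = k; the empty index set is counted.
    IsN₀ : ∀ {m} → Vector Carrier m → Pred ℕ ℓ
    IsN₀ S = HasCardinality (ZeroSum S)

    IsDavenportConstant : Pred ℕ (c ⊔ ℓ)
    IsDavenportConstant = IsLeastPositive λ l →
      ∀ t → l ≤ t → (S : Vector Carrier t) → ∃[ I ] Nonempty I × ZeroSum S I

    -- The subsequence of S with index set T is zero-sum free.
    ZeroSumFree : ∀ {m} → Vector Carrier m → Pred (Subset m) ℓ
    ZeroSumFree S T = ¬ (∃[ I ] I ⊆ T × Nonempty I × ZeroSum S I)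

    IsMaximalZeroSumFree : ∀ {m} → Vector Carrier m → Pred (Subset m) ℓ
    IsMaximalZeroSumFree S T =
      ZeroSumFree S T × (∀ T′ → ZeroSumFree S T′ → ∣ T′ ∣ ≤ ∣ T ∣)

    -- S = ∏_{i=1}^r gᵢ ∏_{j=1}^k hⱼ as unordered sequences, by means of a
    -- bijection π from the r + k positions on the right to those of S, with T
    -- the set of positions of the gᵢ.  The sets J j are the I_j.
    record Splits {m} (S : Vector Carrier m) (T : Subset m) (r k : ℕ) : Set ℓ where
      field
        π : Permutation (r + k) m

      g : Vector Carrier r
      g i = S (π ⟨$⟩ʳ (i ↑ˡ k))

      h : Vector Carrier k
      h j = S (π ⟨$⟩ʳ (r ↑ʳ j))

      field
        g∈T      : ∀ i → π ⟨$⟩ʳ (i ↑ˡ k) ∈ₛ T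
        h∉T      : ∀ j → π ⟨$⟩ʳ (r ↑ʳ j) ∉ₛ T
        J        : Fin k → Subset r
        disjoint : ∀ i j → i ≢ j → Empty (J i ∩ J j)
        relation : ∀ j → ∃[ b ] ∃[ a ]
                     A b × Weights (J j) a × b · h j ≈ weightedSum g (J j) a

{-# OPTIONS --safe #-}

module Submission where

open import Defs
open import Algebra.Bundles using (AbelianGroup; Monoid)
import Algebra.Definitions.RawMonoid as RawMonoidDefinitions
open import Algebra.Morphism.Structures using (module GroupMorphisms)
import Algebra.Properties.CommutativeMonoid.Mult as Mult
import Algebra.Properties.CommutativeMonoid.Sum as CommutativeMonoidSum
import Algebra.Properties.Monoid.Sum as MonoidSum
import Algebra.Properties.Semiring.Sum as SemiringSum
open import Data.Bool.Base using (Bool; true; false; if_then_else_)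
import Data.Bool.Properties as Bool
open import Data.Fin.Base using (Fin; zero; suc; _↑ˡ_; _↑ʳ_; splitAt; punchIn; fromℕ<)
open import Data.Fin.Permutation
  using (Permutation; _⟨$⟩ʳ_; _⟨$⟩ˡ_; insert; insert-punchIn; inverseˡ; ↔⇒≡)
import Data.Fin.Permutation as Perm
open import Data.Fin.Properties
  using (any?; _≟_; splitAt-↑ˡ; splitAt-↑ʳ; injective⇒≤; ↑ˡ-injective)
open import Data.Fin.Subset using (Subset; _⊆_; Nonempty; Empty; _∩_)
  renaming (_∈_ to _∈ₛ_; _∉_ to _∉ₛ_; ∣_∣ to #_)
open import Data.Fin.Subset.Properties using (⊆-antisym; x∈p∩q⁻; x∈p∩q⁺)
open import Data.Integer.Base as ℤ using (ℤ; +_; 0ℤ; 1ℤ)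
open import Data.Integer.Divisibility.Signed
  using (_∣?_; divides; ∣⇒∣ᵤ; ∣ᵤ⇒∣; ∣-trans; ∣m∣n⇒∣m+n; ∣m∣n⇒∣m-n; ∣m⇒∣-m
        ; ∣n⇒∣m*n; ∣m⇒∣m*n; *-monoʳ-∣)
open import Data.Integer.DivMod using (_%ℕ_; _/ℕ_; n%ℕd<d; a≡a%ℕn+[a/ℕn]*n)
import Data.Integer.Properties as ℤ
open import Data.Integer.Tactic.RingSolver using (solve-∀)
open import Data.List.Base using (List; []; _∷_; _∷ʳ_; _++_; map; length; replicate)
open import Data.List.Membership.Propositional using (_∈_)
open import Data.List.Membership.Propositional.Properties
  using (∈-∃++; ∈-++⁻; ∈-++⁺ˡ; ∈-++⁺ʳ; ∈-map⁻)
open import Data.List.Properties using (length-++; length-map)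
open import Data.List.Relation.Unary.All as All using (All; []; _∷_)
import Data.List.Relation.Unary.All.Properties as All
open import Data.List.Relation.Unary.AllPairs using ([]; _∷_)
open import Data.List.Relation.Unary.Any using (here; there)
open import Data.List.Relation.Unary.Linked using (Linked; _∷_)
open import Data.List.Relation.Unary.Unique.Propositional using (Unique)
import Data.List.Relation.Unary.Unique.Propositional.Properties as Unique
open import Data.Nat.Base as ℕ using (ℕ; zero; suc; _∸_; _^_; _≤_; _<_; z≤n; s≤s; NonZero)
import Data.Nat.Divisibility as ℕ
open import Data.Nat.Primality using (Prime; euclidsLemma; prime⇒nonZero; prime⇒nonTrivial)
open import Data.Nat.Primality.Factorisation using (factorise)
import Data.Nat.Properties as ℕ
open import Data.Product.Base using (_×_; _,_; proj₁; proj₂; ∃-syntax; Σ-syntax)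
open import Data.Sum.Base as Sum using (_⊎_; inj₁; inj₂; [_,_]′)
open import Data.Unit.Polymorphic using (tt)
open import Data.Vec.Base using ([]; _∷_; lookup; tabulate; here; there)
open import Data.Vec.Functional using (Vector)
open import Data.Vec.Properties
  using (lookup∘tabulate; []=⇒lookup; lookup⇒[]=; ∷-injectiveʳ; ≡-dec)
open import Function.Base using (_∘_; const)
open import Function.Bundles using (Equivalence; Injection)
open import Function.Properties.Inverse using (↔⇒↣)
open import Level using (_⊔_)
open import Relation.Binary.Definitions using (DecidableEquality)
open import Relation.Binary.PropositionalEquality
  using (_≡_; _≢_; refl; sym; trans; cong; cong₂; subst; subst₂; module ≡-Reasoning)
open import Relation.Nullary using (¬_; yes; no; does; contradiction)
open import Relation.Nullary.Decidable using (¬?; decidable-stable; dec-true; dec-false)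
open import Relation.Unary using (Pred)

-- Linear algebra over F_p meets a count of supports. `eliminate` splits the coordinate vectors of
-- the terms modulo `p` into `t ≤ r` generating ones (inner positions) and `k = m - t` others (outer
-- positions), and `rel` combines the `k` resulting relations. `relation⇒zeroSum` turns such a
-- relation into a weighted zero-sum of the sequence, with weights that are multiples of `q`:
-- multiplication by `q` kills `H` and every coordinate divisible by `p`.
--
-- Every set of outer positions is the outer part of such a support, so N is at least 2^(m - t). A
-- basis of C_n^r shows `r < D` (`r<davenport`), so the assumed value of N is at most 2^(m - r).
-- Both bounds together force `t = r` and N = 2^k, and a zero-sum index set is then determined by
-- its outer part (`zeroSum-unique`). The conclusions follow from this rigidity: `T-zeroSumFree`
-- uses the empty outer part, and `supports-disjoint` compares two relations with the same outer
-- part. Finally `k ≤ r`, because the sets `J j` are disjoint and nonempty.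

-- Let n = q p with p a prime such that q kills H (it exists because exp(H) is
-- a proper divisor of n).  Then q G is isomorphic to F_p^r, so
-- every F_p-relation among the vectors q S_i yields a zero-sum supported on
-- its nonzero coefficients.  If t ≤ r of these vectors span the other k, then
-- relations with any prescribed support among the k others exist, whence
-- N ≥ 2^k = 2^(m - t).  As D > r (take a basis of C_n^r), the equality forces
-- t = r and makes the support of a zero-sum depend only on its part among the
-- k others.  Empty part: the r spanning terms are zero-sum free, and of maximal
-- length by linear dependence in F_p^r.  Singletons: the h_j, with sets I_j
-- that are nonempty since h_j has order n > q.  If i lay in I_j ∩ I_j′, one
-- combination of the relations for h_j and h_j′ would cancel g_i, and flipping
-- a sign in it would not, as p ≠ 2; yet both involve the same h's.
module _ where
  open import Data.Integer.Base using (_+_; _*_; _-_; -_)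
  open import Data.Integer.Divisibility.Signed using (_∣_)
  open SemiringSum ℤ.+-*-semiring
    using (sum; sum-cong-≗; sum-permute; sum-replicate-zero; ∑-comm; ∑-distrib-+
          ; *-distribˡ-sum; *-distribʳ-sum)

  -- Sums and divisibility

  module _ {a ℓ} (M : Monoid a ℓ) where
    open Monoid M renaming (Carrier to X; sym to ≈-sym; trans to ≈-trans)
    private module M = MonoidSum M

    sum-↑ : ∀ t k (f : Vector X (t ℕ.+ k)) →
            M.sum f ≈ M.sum (f ∘ (_↑ˡ k)) ∙ M.sum (f ∘ (t ↑ʳ_))
    sum-↑ zero    k f = ≈-sym (identityˡ _)
    sum-↑ (suc t) k f = ≈-trans (∙-congˡ (sum-↑ t k (f ∘ suc))) (≈-sym (assoc _ _ _))

  ∣-sum : ∀ {k n} (f : Vector ℤ n) → (∀ i → k ∣ f i) → k ∣ sum f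
  ∣-sum {n = zero}  f h = divides 0ℤ refl
  ∣-sum {n = suc n} f h = ∣m∣n⇒∣m+n (h zero) (∣-sum (f ∘ suc) (h ∘ suc))

  sum-combination : ∀ {s t} (d : Vector ℤ s) (c : Fin s → Fin t → ℤ) (x : Vector ℤ t) →
    sum (λ i → sum (λ j → d j * c j i) * x i) ≡ sum (λ j → d j * sum (λ i → c j i * x i))
  sum-combination {s} {t} d c x = begin
    sum (λ i → sum (λ j → d j * c j i) * x i)
      ≡⟨ sum-cong-≗ (λ i → *-distribʳ-sum (x i) (λ j → d j * c j i)) ⟩
    sum (λ i → sum (λ j → d j * c j i * x i))
      ≡⟨ ∑-comm {t} {s} (λ i j → d j * c j i * x i) ⟩
    sum (λ j → sum (λ i → d j * c j i * x i))
      ≡⟨ sum-cong-≗ (λ j → sum-cong-≗ (λ i → ℤ.*-assoc (d j) (c j i) (x i))) ⟩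
    sum (λ j → sum (λ i → d j * (c j i * x i)))
      ≡⟨ sum-cong-≗ (λ j → *-distribˡ-sum (d j) (λ i → c j i * x i)) ⟨
    sum (λ j → d j * sum (λ i → c j i * x i)) ∎
    where open ≡-Reasoning

  prime∣* : ∀ {p} → Prime p → ∀ x y → + p ∣ x * y → + p ∣ x ⊎ + p ∣ y
  prime∣* {p} pr x y h = Sum.map ∣ᵤ⇒∣ ∣ᵤ⇒∣
    (euclidsLemma ℤ.∣ x ∣ ℤ.∣ y ∣ pr (subst (p ℕ.∣_) (ℤ.abs-* x y) (∣⇒∣ᵤ h)))

  prime∤1 : ∀ {p} → Prime p → ¬ (+ p ∣ 1ℤ)
  prime∤1 {p} pr h = ℕ.nonTrivial⇒≢1 {{prime⇒nonTrivial pr}} (ℕ.∣1⇒≡1 (∣⇒∣ᵤ h))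

  -- Elimination modulo p

  -- In the order given by `π`, the first `t` rows span the other `k` modulo `p`. The factor `b j`
  -- takes the place of a division: it is invertible modulo `p`.
  record Elimination (p : ℕ) {m r} (X : Fin m → Fin r → ℤ) : Set where
    field
      {t k}    : ℕ
      t≤r      : t ≤ r
      π        : Permutation (t ℕ.+ k) m
      b        : Fin k → ℤ
      p∤b      : ∀ j → ¬ (+ p ∣ b j)
      c        : Fin k → Fin t → ℤ
      relation : ∀ j l → + p ∣ b j * X (π ⟨$⟩ʳ (t ↑ʳ j)) l -
                                sum (λ i → c j i * X (π ⟨$⟩ʳ (i ↑ˡ k)) l)

  -- The pivot row is subtracted after cross-multiplication, which avoids
  -- inverting the pivot modulo p.
  crossEliminate : ∀ {t} (b y y₀ w w₀ : ℤ) (c x x₀ : Vector ℤ t) →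
    b * (w₀ * y - y₀ * w) - sum (λ i → c i * (w₀ * x i - x₀ i * w)) ≡
    w₀ * b * y - ((b * y₀ - sum (λ i → c i * x₀ i)) * w + sum (λ i → w₀ * c i * x i))
  crossEliminate {zero}  b y y₀ w w₀ c x x₀ = base b y y₀ w w₀
    where
    base : ∀ b y y₀ w w₀ → b * (w₀ * y - y₀ * w) - 0ℤ ≡ w₀ * b * y - ((b * y₀ - 0ℤ) * w + 0ℤ)
    base = solve-∀
  crossEliminate {suc t} b y y₀ w w₀ c x x₀ = begin
    A - (cx + s)      ≡⟨ step₁ A cx s ⟩
    (A - s) - cx      ≡⟨ cong (_- cx) (crossEliminate b y y₀ w w₀ (c ∘ suc) (x ∘ suc) (x₀ ∘ suc)) ⟩
    _                 ≡⟨ step₂ (b * y₀) w w₀ (w₀ * b * y) (c zero) (x zero) (x₀ zero) _ _ ⟩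
    _                 ∎
    where
    open ≡-Reasoning
    A = b * (w₀ * y - y₀ * w)
    cx = c zero * (w₀ * x zero - x₀ zero * w)
    s = sum (λ i → c (suc i) * (w₀ * x (suc i) - x₀ (suc i) * w))

    step₁ : ∀ A cx s → A - (cx + s) ≡ (A - s) - cx
    step₁ = solve-∀

    step₂ : ∀ by w w₀ B c x x₀ s s′ →
      (B - ((by - s) * w + s′)) - c * (w₀ * x - x₀ * w) ≡
      B - ((by - (c * x₀ + s)) * w + (w₀ * c * x + s′))
    step₂ = solve-∀

  -- Induction on the columns. A first column divisible by `p` is discarded; otherwise a row with a
  -- first entry prime to `p` joins the spanning rows and clears that column in the others. Each
  -- column thus costs at most one spanning row.
  eliminate : ∀ {p} → Prime p → ∀ r {m} (X : Fin m → Fin r → ℤ) → Elimination p X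
  eliminate pr zero X = record
    { t≤r = z≤n ; π = Perm.id ; b = λ _ → 1ℤ ; p∤b = λ _ → prime∤1 pr
    ; c = λ _ () ; relation = λ _ () }
  eliminate {p} pr (suc r) {m} X with any? (λ i → ¬? (+ p ∣? X i zero))
  ... | no ¬pivot = record
    { t≤r = ℕ.m≤n⇒m≤1+n E.t≤r ; π = E.π ; b = E.b ; p∤b = E.p∤b ; c = E.c ; relation = rel }
    where
    module E = Elimination (eliminate pr r (λ i l → X i (suc l)))

    p∣X₀ : ∀ i → + p ∣ X i zero
    p∣X₀ i = decidable-stable (+ p ∣? X i zero) (λ h → ¬pivot (i , h))

    rel : ∀ j l → + p ∣ E.b j * X (E.π ⟨$⟩ʳ (E.t ↑ʳ j)) l -
                          sum (λ i → E.c j i * X (E.π ⟨$⟩ʳ (i ↑ˡ E.k)) l)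
    rel j zero    = ∣m∣n⇒∣m-n (∣n⇒∣m*n (E.b j) (p∣X₀ _))
                      (∣-sum _ (λ i → ∣n⇒∣m*n (E.c j i) (p∣X₀ _)))
    rel j (suc l) = E.relation j l
  eliminate {p} pr (suc r) {suc m} X | yes (i₀ , p∤w₀) = record
    { t≤r = s≤s E.t≤r
    ; π = insert zero i₀ E.π
    ; b = λ j → w₀ * E.b j
    ; p∤b = λ j h → [ p∤w₀ , E.p∤b j ]′ (prime∣* pr w₀ (E.b j) h)
    ; c = c
    ; relation = rel
    }
    where
    w₀ = X i₀ zero

    Y : Fin m → Fin (suc r) → ℤ
    Y i = X (punchIn i₀ i)

    X′ : Fin m → Fin (suc r) → ℤ
    X′ i l = w₀ * Y i l - Y i zero * X i₀ l

    module E = Elimination (eliminate pr r (λ i l → X′ i (suc l)))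

    out : Fin E.k → Fin m
    out j = E.π ⟨$⟩ʳ (E.t ↑ʳ j)

    inn : Fin E.t → Fin m
    inn i = E.π ⟨$⟩ʳ (i ↑ˡ E.k)

    c : Fin E.k → Fin (suc E.t) → ℤ
    -- The pivot row absorbs the defect of the relation in column zero, which is the factor of `w`
    -- in `crossEliminate`.
    c j zero    = E.b j * Y (out j) zero - sum (λ i → E.c j i * Y (inn i) zero)
    c j (suc i) = w₀ * E.c j i

    relX′ : ∀ j l → + p ∣ E.b j * X′ (out j) l - sum (λ i → E.c j i * X′ (inn i) l)
    relX′ j zero = ∣m∣n⇒∣m-n (∣n⇒∣m*n (E.b j) (p∣X′₀ _))
                     (∣-sum _ (λ i → ∣n⇒∣m*n (E.c j i) (p∣X′₀ _)))
      where
      cancel : ∀ x y → x * y - y * x ≡ 0ℤ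
      cancel = solve-∀

      p∣X′₀ : ∀ i → + p ∣ X′ i zero
      p∣X′₀ i = divides 0ℤ (cancel w₀ (Y i zero))
    relX′ j (suc l) = E.relation j l

    rel : ∀ j l →
      + p ∣ w₀ * E.b j * X (insert zero i₀ E.π ⟨$⟩ʳ (suc E.t ↑ʳ j)) l -
             sum (λ i → c j i * X (insert zero i₀ E.π ⟨$⟩ʳ (i ↑ˡ E.k)) l)
    rel j l = subst (+ p ∣_) (begin
      E.b j * X′ (out j) l - sum (λ i → E.c j i * X′ (inn i) l)
        ≡⟨ crossEliminate (E.b j) (Y (out j) l) (Y (out j) zero) (X i₀ l) w₀
             (E.c j) (λ i → Y (inn i) l) (λ i → Y (inn i) zero) ⟩
      w₀ * E.b j * Y (out j) l - (c j zero * X i₀ l + sum (λ i → c j (suc i) * Y (inn i) l))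
        ≡⟨ cong₂ (λ x s → w₀ * E.b j * x - (c j zero * X i₀ l + s))
             (insert-X (E.t ↑ʳ j))
             (sum-cong-≗ (λ i → cong (c j (suc i) *_) (insert-X (i ↑ˡ E.k)))) ⟩
      _ ∎) (relX′ j l)
      where
      open ≡-Reasoning
      insert-X : ∀ y → Y (E.π ⟨$⟩ʳ y) l ≡ X (insert zero i₀ E.π ⟨$⟩ʳ suc y) l
      insert-X y = cong (λ x → X x l) (sym (insert-punchIn zero i₀ E.π y))

  -- Counting supports

  length-mono-⊆ : ∀ {a} {X : Set a} {ys xs : List X} → Unique ys →
                  (∀ {y} → y ∈ ys → y ∈ xs) → length ys ≤ length xs
  length-mono-⊆ [] h = z≤n
  length-mono-⊆ {ys = y ∷ ys} (y∉ys ∷ u) h with ∈-∃++ (h (here refl))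
  ... | as , bs , refl = begin
    suc (length ys)                ≤⟨ s≤s (length-mono-⊆ u h′) ⟩
    suc (length (as ++ bs))        ≡⟨ cong suc (length-++ as) ⟩
    suc (length as ℕ.+ length bs)  ≡⟨ ℕ.+-suc (length as) (length bs) ⟨
    length as ℕ.+ suc (length bs)  ≡⟨ length-++ as ⟨
    length (as ++ y ∷ bs)          ∎
    where
    open ℕ.≤-Reasoning
    h′ : ∀ {z} → z ∈ ys → z ∈ as ++ bs
    h′ z∈ys with ∈-++⁻ as (h (there z∈ys))
    ... | inj₁ z∈as         = ∈-++⁺ˡ z∈as
    ... | inj₂ (here refl)  = contradiction refl (All.lookup y∉ys z∈ys)
    ... | inj₂ (there z∈bs) = ∈-++⁺ʳ as z∈bs

  subsets : ∀ k → List (Subset k)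
  subsets zero    = [] ∷ []
  subsets (suc k) = map (true ∷_) (subsets k) ++ map (false ∷_) (subsets k)

  subsets-unique : ∀ k → Unique (subsets k)
  subsets-unique zero    = [] ∷ []
  subsets-unique (suc k) = Unique.++⁺
    (Unique.map⁺ ∷-injectiveʳ (subsets-unique k))
    (Unique.map⁺ ∷-injectiveʳ (subsets-unique k))
    disjoint
    where
    disjoint : ∀ {v} → ¬ (v ∈ map (true ∷_) (subsets k) × v ∈ map (false ∷_) (subsets k))
    disjoint (p , q) with ∈-map⁻ (true ∷_) p | ∈-map⁻ (false ∷_) q
    ... | _ , _ , refl | _ , _ , ()

  length-subsets : ∀ k → length (subsets k) ≡ 2 ^ k
  length-subsets zero    = refl
  length-subsets (suc k) = begin
    length (map (true ∷_) (subsets k) ++ map (false ∷_) (subsets k))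
      ≡⟨ length-++ (map (true ∷_) (subsets k)) ⟩
    length (map (true ∷_) (subsets k)) ℕ.+ length (map (false ∷_) (subsets k))
      ≡⟨ cong₂ ℕ._+_ (length-map′ true) (trans (length-map′ false) (sym (ℕ.+-identityʳ _))) ⟩
    2 ^ suc k ∎
    where
    open ≡-Reasoning
    length-map′ : ∀ x → length (map {B = Subset (suc k)} (x ∷_) (subsets k)) ≡ 2 ^ k
    length-map′ x = trans (length-map (x ∷_) (subsets k)) (length-subsets k)

  module _ {a ℓ} {X : Set a} {Z : Pred X ℓ} {N : ℕ} (card : HasCardinality Z N)
           {k} (σ : Subset k → X) (ρ : X → Subset k)
           (ρ∘σ : ∀ J → ρ (σ J) ≡ J) (Zσ : ∀ J → Z (σ J)) where

    private
      xs = proj₁ card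
      ∈xs = proj₁ (proj₂ (proj₂ card))
      σs = map σ (subsets k)

      length-σs : length σs ≡ 2 ^ k
      length-σs = trans (length-map σ (subsets k)) (length-subsets k)

      σs-unique : Unique σs
      σs-unique = Unique.map⁺ (λ {I} {J} eq → trans (sym (ρ∘σ I)) (trans (cong ρ eq) (ρ∘σ J)))
                              (subsets-unique k)

      σs⊆xs : ∀ {x} → x ∈ σs → x ∈ xs
      σs⊆xs x∈ with ∈-map⁻ σ x∈
      ... | J , _ , refl = Equivalence.from (∈xs (σ J)) (Zσ J)

      bound : ∀ {ys} → Unique ys → (∀ {y} → y ∈ ys → y ∈ xs) → length ys ≤ N
      bound u h = subst (_ ≤_) (proj₂ (proj₂ (proj₂ card))) (length-mono-⊆ u h)

    -- Since `ρ` recovers `J` from `σ J`, the 2^k values of `σ` are distinct members of `Z`.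
    section⇒2^k≤N : 2 ^ k ≤ N
    section⇒2^k≤N = subst (_≤ N) length-σs (bound σs-unique σs⊆xs)

    -- An `x` different from `σ (ρ x)` is no value of `σ`, so it would be one more member of `Z`
    -- beside the 2^k values.
    section⇒surjective : DecidableEquality X → N ≤ 2 ^ k → ∀ x → Z x → x ≡ σ (ρ x)
    section⇒surjective _≟ˣ_ N≤2^k x Zx with x ≟ˣ σ (ρ x)
    ... | yes eq = eq
    ... | no neq = contradiction
      (ℕ.≤-trans (subst (λ l → suc l ≤ N) length-σs (bound (All.¬Any⇒All¬ σs x∉σs ∷ σs-unique) h)) N≤2^k)
      ℕ.1+n≰n
      where
      x∉σs : ¬ (x ∈ σs)
      x∉σs x∈ with ∈-map⁻ σ x∈
      ... | J , _ , refl = neq (sym (cong σ (ρ∘σ J)))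

      h : ∀ {y} → y ∈ x ∷ σs → y ∈ xs
      h (here refl) = Equivalence.from (∈xs x) Zx
      h (there y∈)  = σs⊆xs y∈

  -- Index sets and subfamilies

  _≟ₛ_ : ∀ {m} → DecidableEquality (Subset m)
  _≟ₛ_ = ≡-dec Bool._≟_

  ∈-tabulate⁺ : ∀ {m} {f : Fin m → Bool} {x} → f x ≡ true → x ∈ₛ tabulate f
  ∈-tabulate⁺ {f = f} {x} eq = lookup⇒[]= x (tabulate f) (trans (lookup∘tabulate f x) eq)

  ∈-tabulate⁻ : ∀ {m} {f : Fin m → Bool} {x} → x ∈ₛ tabulate f → f x ≡ true
  ∈-tabulate⁻ {f = f} {x} x∈ = trans (sym (lookup∘tabulate f x)) ([]=⇒lookup x∈)

  preimage : ∀ {k m} → (Fin k → Fin m) → Subset m → Subset k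
  preimage f s = tabulate (lookup s ∘ f)

  ∈-preimage⁺ : ∀ {k m} (f : Fin k → Fin m) {s j} → f j ∈ₛ s → j ∈ₛ preimage f s
  ∈-preimage⁺ f fj∈s = ∈-tabulate⁺ ([]=⇒lookup fj∈s)

  ∈-preimage⁻ : ∀ {k m} (f : Fin k → Fin m) {s j} → j ∈ₛ preimage f s → f j ∈ₛ s
  ∈-preimage⁻ f {s} {j} j∈ = lookup⇒[]= (f j) s (∈-tabulate⁻ j∈)

  -- Presents the rows with index in `P` as a family of their own, to which elimination applies.
  enum : ∀ {m} (P : Subset m) → Fin (# P) → Fin m
  enum (true  ∷ P) zero    = zero
  enum (true  ∷ P) (suc i) = suc (enum P i)
  enum (false ∷ P) i       = suc (enum P i)

  index : ∀ {m} (P : Subset m) {x} → x ∈ₛ P → ∃[ i ] enum P i ≡ x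
  index (true  ∷ P) here = zero , refl
  index (true  ∷ P) (there x∈P) with i , eq ← index P x∈P = suc i , cong suc eq
  index (false ∷ P) (there x∈P) with i , eq ← index P x∈P = i , cong suc eq

  injective⇒≤∣∣ : ∀ {t m} (P : Subset m) (f : Fin t → Fin m) → (∀ {i j} → f i ≡ f j → i ≡ j) →
                 (∀ i → f i ∈ₛ P) → t ≤ # P
  injective⇒≤∣∣ P f f-injective f∈P = injective⇒≤ {f = λ i → proj₁ (index P (f∈P i))}
    λ {i} {j} eq → f-injective
      (trans (sym (proj₂ (index P (f∈P i)))) (trans (cong (enum P) eq) (proj₂ (index P (f∈P j)))))

  extend : ∀ {m} (P : Subset m) → Vector ℤ (# P) → Vector ℤ m
  extend (true  ∷ P) u zero    = u zero
  extend (true  ∷ P) u (suc x) = extend P (u ∘ suc) x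
  extend (false ∷ P) u zero    = 0ℤ
  extend (false ∷ P) u (suc x) = extend P u x

  extend-enum : ∀ {m} (P : Subset m) u i → extend P u (enum P i) ≡ u i
  extend-enum (true  ∷ P) u zero    = refl
  extend-enum (true  ∷ P) u (suc i) = extend-enum P (u ∘ suc) i
  extend-enum (false ∷ P) u i       = extend-enum P u i

  extend-outside : ∀ {m} (P : Subset m) u x → x ∈ₛ P ⊎ extend P u x ≡ 0ℤ
  extend-outside (true  ∷ P) u zero    = inj₁ here
  extend-outside (false ∷ P) u zero    = inj₂ refl
  extend-outside (true  ∷ P) u (suc x) = [ inj₁ ∘ there , inj₂ ]′ (extend-outside P (u ∘ suc) x)
  extend-outside (false ∷ P) u (suc x) = [ inj₁ ∘ there , inj₂ ]′ (extend-outside P u x)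

  sum-extend : ∀ {m} (P : Subset m) u (v : Vector ℤ m) →
               sum (λ x → extend P u x * v x) ≡ sum (λ i → u i * v (enum P i))
  sum-extend []          u v = refl
  sum-extend (true  ∷ P) u v = cong (ℤ._+_ (u zero * v zero)) (sum-extend P (u ∘ suc) (v ∘ suc))
  sum-extend (false ∷ P) u v = trans (ℤ.+-identityˡ _) (sum-extend P u (v ∘ suc))

  -- Linear relations modulo p and their supports

  module _ (p : ℕ) where

    supp : ∀ {m} → Vector ℤ m → Subset m
    supp u = tabulate (λ x → does (¬? (+ p ∣? u x)))

    ∈supp⁺ : ∀ {m} (u : Vector ℤ m) {x} → ¬ (+ p ∣ u x) → x ∈ₛ supp u
    ∈supp⁺ u p∤ux = ∈-tabulate⁺ (dec-true (¬? (+ p ∣? _)) p∤ux)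

    ∈supp⁻ : ∀ {m} (u : Vector ℤ m) {x} → x ∈ₛ supp u → ¬ (+ p ∣ u x)
    ∈supp⁻ u {x} x∈ p∣ux with () ←
      trans (sym (∈-tabulate⁻ x∈)) (dec-false (¬? (+ p ∣? u x)) (λ p∤ux → p∤ux p∣ux))

    IsRelation : ∀ {m r} → (Fin m → Fin r → ℤ) → Pred (Vector ℤ m) _
    IsRelation X u = ∀ l → + p ∣ sum (λ x → u x * X x l)

  module Relations {p} (pr : Prime p) {m r} {X : Fin m → Fin r → ℤ} (E : Elimination p X) where
    open Elimination E

    inner : Fin t → Fin m
    inner i = π ⟨$⟩ʳ (i ↑ˡ k)

    outer : Fin k → Fin m
    outer j = π ⟨$⟩ʳ (t ↑ʳ j)

    innerPart : Vector ℤ k → Vector ℤ t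
    innerPart d i = sum (λ j → - d j * c j i)

    outerPart : Vector ℤ k → Vector ℤ k
    outerPart d j = d j * b j

    -- The combination with coefficients `d j` of the `k` relations found by elimination. Each of
    -- these has coefficient `b j` at `outer j` and `- c j i` at `inner i`.
    rel : Vector ℤ k → Vector ℤ m
    rel d x = [ innerPart d , outerPart d ]′ (splitAt t (π ⟨$⟩ˡ x))

    rel-inner : ∀ d i → rel d (inner i) ≡ innerPart d i
    rel-inner d i = cong [ innerPart d , outerPart d ]′
      (trans (cong (splitAt t) (inverseˡ π)) (splitAt-↑ˡ t i k))

    rel-outer : ∀ d j → rel d (outer j) ≡ outerPart d j
    rel-outer d j = cong [ innerPart d , outerPart d ]′
      (trans (cong (splitAt t) (inverseˡ π)) (splitAt-↑ʳ t k j))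

    rel-isRelation : ∀ d → IsRelation p X (rel d)
    rel-isRelation d l = subst (+ p ∣_) (sym eq)
      (∣-sum _ (λ j → ∣n⇒∣m*n (d j) (relation j l)))
      where
      open ≡-Reasoning
      F : Vector ℤ m
      F x = rel d x * X x l

      s : Vector ℤ k
      s j = sum (λ i → c j i * X (inner i) l)

      factor : ∀ d s b x → - d * s + d * b * x ≡ d * (b * x - s)
      factor = solve-∀

      eq : sum F ≡ sum (λ j → d j * (b j * X (outer j) l - s j))
      eq = begin
        sum F                                     ≡⟨ sum-permute F π ⟩
        sum (F ∘ (π ⟨$⟩ʳ_))                       ≡⟨ sum-↑ ℤ.+-0-monoid t k (F ∘ (π ⟨$⟩ʳ_)) ⟩
        sum (F ∘ inner) + sum (F ∘ outer)
          ≡⟨ cong₂ _+_ (sum-cong-≗ (λ i → cong (_* X (inner i) l) (rel-inner d i)))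
                       (sum-cong-≗ (λ j → cong (_* X (outer j) l) (rel-outer d j))) ⟩
        sum (λ i → innerPart d i * X (inner i) l) + sum (λ j → d j * b j * X (outer j) l)
          ≡⟨ cong (λ s → s + sum (λ j → d j * b j * X (outer j) l)) (sum-combination (λ j → - d j) c (λ i → X (inner i) l)) ⟩
        sum (λ j → - d j * s j) + sum (λ j → d j * b j * X (outer j) l)
          ≡⟨ ∑-distrib-+ (λ j → - d j * s j) (λ j → d j * b j * X (outer j) l) ⟨
        sum (λ j → - d j * s j + d j * b j * X (outer j) l)
          ≡⟨ sum-cong-≗ (λ j → factor (d j) (s j) (b j) (X (outer j) l)) ⟩
        sum (λ j → d j * (b j * X (outer j) l - s j)) ∎

    -- The coefficient at `outer j` is `d j * b j` with `b j` prime to `p`. Hence the outer part of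
    -- a support can be prescribed at will.
    preimage-supp-rel : ∀ d → preimage outer (supp p (rel d)) ≡ supp p d
    preimage-supp-rel d = ⊆-antisym
      (λ {j} j∈ → ∈supp⁺ p d λ p∣dj → ∈supp⁻ p (rel d) (∈-preimage⁻ outer j∈)
         (subst (+ p ∣_) (sym (rel-outer d j)) (∣m⇒∣m*n (b j) p∣dj)))
      (λ {j} j∈ → ∈-preimage⁺ outer (∈supp⁺ p (rel d) λ h →
         [ ∈supp⁻ p d j∈ , p∤b j ]′ (prime∣* pr (d j) (b j) (subst (+ p ∣_) (rel-outer d j) h))))

    indicator : Subset k → Vector ℤ k
    indicator J j = if lookup J j then 1ℤ else 0ℤ

    supp-indicator : ∀ J → supp p (indicator J) ≡ J
    supp-indicator J = ⊆-antisym to from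
      where
      to : supp p (indicator J) ⊆ J
      to {j} j∈ with ∈supp⁻ p (indicator J) j∈
      ... | h with lookup J j in eq
      ...   | true  = lookup⇒[]= j J eq
      ...   | false = contradiction (divides 0ℤ refl) h

      from : J ⊆ supp p (indicator J)
      from {j} j∈ = ∈supp⁺ p (indicator J) λ h → prime∤1 pr
        (subst (λ b → + p ∣ (if b then 1ℤ else 0ℤ)) ([]=⇒lookup j∈) h)

    lift : Subset k → Subset m
    lift J = supp p (rel (indicator J))

    preimage-lift : ∀ J → preimage outer (lift J) ≡ J
    preimage-lift J = trans (preimage-supp-rel (indicator J)) (supp-indicator J)

  -- Elimination on more than `r` rows leaves at least one outer row. With all `d j = 1` the
  -- coefficient there is `b j₀`, so the relation is nontrivial.
  dependent : ∀ {p} → Prime p → ∀ {m r} (X : Fin m → Fin r → ℤ) (P : Subset m) → r ℕ.< # P →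
    Σ[ u ∈ Vector ℤ m ] IsRelation p X u × supp p u ⊆ P × ∃[ x ] x ∈ₛ supp p u
  dependent {p} pr {m} {r} X P r<∣P∣ =
    u , isRel , u⊆P , enum P (outer j₀) , ∈supp⁺ p u λ h → p∤b j₀
      (subst (+ p ∣_) (trans (extend-enum P _ (outer j₀)) (trans (rel-outer (λ _ → 1ℤ) j₀) (ℤ.*-identityˡ (b j₀)))) h)
    where
    E = eliminate pr r (X ∘ enum P)
    open Elimination E
    open Relations pr E

    0<k : 0 ℕ.< k
    0<k = ℕ.+-cancelˡ-< t 0 k (begin-strict
      t ℕ.+ 0  ≡⟨ ℕ.+-identityʳ t ⟩
      t        ≤⟨ t≤r ⟩
      r        <⟨ r<∣P∣ ⟩
      # P      ≡⟨ ↔⇒≡ π ⟨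
      t ℕ.+ k  ∎)
      where open ℕ.≤-Reasoning

    j₀ : Fin k
    j₀ = fromℕ< 0<k

    u : Vector ℤ m
    u = extend P (rel (λ _ → 1ℤ))

    isRel : IsRelation p X u
    isRel l = subst (+ p ∣_) (sym (sum-extend P _ (λ x → X x l))) (rel-isRelation (λ _ → 1ℤ) l)

    u⊆P : supp p u ⊆ P
    u⊆P {x} x∈ with extend-outside P (rel (λ _ → 1ℤ)) x
    ... | inj₁ x∈P  = x∈P
    ... | inj₂ ux≡0 = contradiction (subst (+ p ∣_) (sym ux≡0) (divides 0ℤ refl)) (∈supp⁻ p u x∈)

  -- Kronecker delta and residues

  δ : ∀ {n} → Fin n → Vector ℤ n
  δ zero    zero    = 1ℤ
  δ zero    (suc j) = 0ℤ
  δ (suc i) zero    = 0ℤ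
  δ (suc i) (suc j) = δ i j

  δ≡0⊎≡ : ∀ {n} (i j : Fin n) → δ i j ≡ 0ℤ ⊎ i ≡ j
  δ≡0⊎≡ zero    zero    = inj₂ refl
  δ≡0⊎≡ zero    (suc j) = inj₁ refl
  δ≡0⊎≡ (suc i) zero    = inj₁ refl
  δ≡0⊎≡ (suc i) (suc j) = Sum.map₂ (cong suc) (δ≡0⊎≡ i j)

  sum-δ : ∀ {n} (j : Fin n) (v : Vector ℤ n) → sum (λ i → δ j i * v i) ≡ v j
  sum-δ {suc n} zero v = trans
    (cong₂ _+_ (ℤ.*-identityˡ (v zero)) (sum-replicate-zero n))
    (ℤ.+-identityʳ (v zero))
  sum-δ (suc j) v = trans (ℤ.+-identityˡ _) (sum-δ j (v ∘ suc))

  %ℕ-≡ : ∀ p .{{_ : NonZero p}} u → + p ∣ + (u %ℕ p) - u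
  %ℕ-≡ p u = divides (- (u /ℕ p))
    (trans (cong (λ v → + (u %ℕ p) - v) (a≡a%ℕn+[a/ℕn]*n u p)) (cancel (+ (u %ℕ p)) (u /ℕ p) (+ p)))
    where
    cancel : ∀ r s p → r - (r + s * p) ≡ - s * p
    cancel = solve-∀

  ∣∧<⇒≡0 : ∀ {p w} → p ℕ.∣ w → w ℕ.< p → w ≡ 0
  ∣∧<⇒≡0 {w = zero}  _   _   = refl
  ∣∧<⇒≡0 {w = suc w} p∣w w<p = contradiction p∣w (ℕ.>⇒∤ w<p)

  ∣-%ℕ : ∀ p .{{_ : NonZero p}} u → + p ∣ u → u %ℕ p ≡ 0
  ∣-%ℕ p u p∣u = ∣∧<⇒≡0 (∣⇒∣ᵤ (subst (+ p ∣_) (cancel (+ (u %ℕ p)) u) (∣m∣n⇒∣m+n (%ℕ-≡ p u) p∣u)))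
                         (n%ℕd<d u p)
    where
    cancel : ∀ r u → (r - u) + u ≡ r
    cancel = solve-∀

  ∤-%ℕ : ∀ p .{{_ : NonZero p}} u → ¬ (+ p ∣ u) → 1 ≤ u %ℕ p
  ∤-%ℕ p u p∤u with u %ℕ p | %ℕ-≡ p u
  ... | suc w | _ = s≤s z≤n
  ... | zero  | h = contradiction (subst (+ p ∣_) (neg-neg u) (∣m⇒∣-m h)) p∤u
    where
    neg-neg : ∀ u → - (0ℤ - u) ≡ u
    neg-neg = solve-∀

  -- Coordinates of G

  module _ {c ℓ} (G : AbelianGroup c ℓ) where
    open AbelianGroup G
      using (Carrier; _≈_; _∙_; ε; rawMonoid; commutativeMonoid; ∙-congˡ; identityˡ)
      renaming (refl to ≈-refl; trans to ≈-trans)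
    open RawMonoidDefinitions rawMonoid using () renaming (_×_ to _·_; sum to sumᴳ)
    open Mult commutativeMonoid using (×-distrib-+)

    ×-sum : ∀ q {s} (f : Vector Carrier s) → q · sumᴳ f ≈ sumᴳ (λ i → q · f i)
    ×-sum q {zero}  f = ×-ε q
      where
      ×-ε : ∀ q → q · ε ≈ ε
      ×-ε zero    = ≈-refl
      ×-ε (suc q) = ≈-trans (identityˡ _) (×-ε q)
    ×-sum q {suc s} f = ≈-trans (×-distrib-+ _ _ q) (∙-congˡ (×-sum q (f ∘ suc)))

    module _ (n : ℕ) (φ : Carrier → ℤ)
             (φ-∙ : ∀ x y → + n ∣ φ (x ∙ y) - (φ x + φ y))
             (φ-ε : + n ∣ φ ε) where

      φ-× : ∀ w x → + n ∣ φ (w · x) - + w * φ x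
      φ-× zero    x = subst (+ n ∣_) (sym (ℤ.+-identityʳ (φ ε))) φ-ε
      φ-× (suc w) x = subst (+ n ∣_) (eq (φ (x ∙ (w · x))) (φ x) (φ (w · x)) (+ w))
        (∣m∣n⇒∣m+n (φ-∙ x (w · x)) (φ-× w x))
        where
        eq : ∀ a b c w → (a - (b + c)) + (c - w * b) ≡ a - (1ℤ + w) * b
        eq = solve-∀

      φ-combination : ∀ {s} (w : Fin s → ℕ) (g : Vector Carrier s) →
        + n ∣ φ (sumᴳ (λ i → w i · g i)) - sum (λ i → + w i * φ (g i))
      φ-combination {zero}  w g = subst (+ n ∣_) (sym (ℤ.+-identityʳ (φ ε))) φ-ε
      φ-combination {suc s} w g = subst (+ n ∣_)
        (eq (φ _) (φ (w zero · g zero)) (φ (sumᴳ (λ i → w (suc i) · g (suc i)))) _ _)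
        (∣m∣n⇒∣m+n (∣m∣n⇒∣m+n (φ-∙ _ _) (φ-× (w zero) (g zero)))
                   (φ-combination (w ∘ suc) (g ∘ suc)))
        where
        eq : ∀ a b c d e → ((a - (b + c)) + (b - d)) + (c - e) ≡ a - (d + e)
        eq = solve-∀

    -- What is retained of the decomposition: the projections to the `r` summands `C n`, elements
    -- dual to them modulo `n`, and in `scale-≈` the fact that `q · x` depends only on the
    -- coordinates of `x` modulo `p`.
    record Coordinates (n r q p : ℕ) : Set (c ⊔ ℓ) where
      field
        coord       : Fin r → Carrier → ℤ
        coord-∙     : ∀ l x y → + n ∣ coord l (x ∙ y) - (coord l x + coord l y)
        coord-ε     : ∀ l → + n ∣ coord l ε
        coord-cong  : ∀ l {x y} → x ≈ y → + n ∣ coord l x - coord l y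
        scale-≈     : ∀ x y → (∀ l → + p ∣ coord l x - coord l y) → q · x ≈ q · y
        basis       : Fin r → Carrier
        coord-basis : ∀ l i → + n ∣ coord l (basis i) - δ l i

  module _ {n : ℕ} where

    coordC : ∀ r → AbelianGroup.Carrier (⨁C (replicate r n)) → Vector ℤ r
    coordC (suc r) (x , xs) zero    = x
    coordC (suc r) (x , xs) (suc l) = coordC r xs l

    fromCoord : ∀ r → Vector ℤ r → AbelianGroup.Carrier (⨁C (replicate r n))
    fromCoord zero    v = tt
    fromCoord (suc r) v = v zero , fromCoord r (v ∘ suc)

    coordC-fromCoord : ∀ r v l → coordC r (fromCoord r v) l ≡ v l
    coordC-fromCoord (suc r) v zero    = refl
    coordC-fromCoord (suc r) v (suc l) = coordC-fromCoord r (v ∘ suc) l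

    coordC-∙ : ∀ r x y l → coordC r (AbelianGroup._∙_ (⨁C (replicate r n)) x y) l ≡
                           coordC r x l + coordC r y l
    coordC-∙ (suc r) x y zero    = refl
    coordC-∙ (suc r) x y (suc l) = coordC-∙ r (proj₂ x) (proj₂ y) l

    coordC-ε : ∀ r l → coordC r (AbelianGroup.ε (⨁C (replicate r n))) l ≡ 0ℤ
    coordC-ε (suc r) zero    = refl
    coordC-ε (suc r) (suc l) = coordC-ε r l

    coordC-cong : ∀ r x y → AbelianGroup._≈_ (⨁C (replicate r n)) x y →
                  ∀ l → + n ∣ coordC r x l - coordC r y l
    coordC-cong (suc r) x y (x≈y , _) zero    = x≈y
    coordC-cong (suc r) x y (_ , x≈y) (suc l) = coordC-cong r (proj₂ x) (proj₂ y) x≈y l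

  module _ {c ℓ} (G : AbelianGroup c ℓ) where
    open AbelianGroup G using (rawMonoid)
    open RawMonoidDefinitions rawMonoid public using () renaming (_×_ to mult)

  module _ (k : ℕ) where

    ×-C : ∀ q x → mult (C k) q x ≡ + q * x
    ×-C zero    x = refl
    ×-C (suc q) x = trans (cong (ℤ._+_ x) (×-C q x)) (eq x (+ q))
      where
      eq : ∀ x q → x + q * x ≡ (1ℤ + q) * x
      eq = solve-∀

    ×-C-≈ : ∀ q x y → + k ∣ + q * (x - y) → AbelianGroup._≈_ (C k) (mult (C k) q x) (mult (C k) q y)
    ×-C-≈ q x y = subst (+ k ∣_)
      (trans (eq (+ q) x y) (sym (cong₂ _-_ (×-C q x) (×-C q y))))
      where
      eq : ∀ q x y → q * (x - y) ≡ q * x - q * y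
      eq = solve-∀

  module _ {c ℓ c′ ℓ′} (H : AbelianGroup c ℓ) (K : AbelianGroup c′ ℓ′) where

    ×-⊕ : ∀ q (x : AbelianGroup.Carrier (H ⊕ K)) →
          mult (H ⊕ K) q x ≡ (mult H q (proj₁ x) , mult K q (proj₂ x))
    ×-⊕ zero    x = refl
    ×-⊕ (suc q) x = cong (AbelianGroup._∙_ (H ⊕ K) x) (×-⊕ q x)

    ×-⊕-≈ : ∀ q (x y : AbelianGroup.Carrier (H ⊕ K)) →
      AbelianGroup._≈_ H (mult H q (proj₁ x)) (mult H q (proj₁ y)) →
      AbelianGroup._≈_ K (mult K q (proj₂ x)) (mult K q (proj₂ y)) →
      AbelianGroup._≈_ (H ⊕ K) (mult (H ⊕ K) q x) (mult (H ⊕ K) q y)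
    ×-⊕-≈ q x y h k = subst₂ (AbelianGroup._≈_ (H ⊕ K)) (sym (×-⊕ q x)) (sym (×-⊕ q y)) (h , k)

  ×-annihilates : ∀ {q} ns → All (ℕ._∣ q) ns → ∀ x y →
    AbelianGroup._≈_ (⨁C ns) (mult (⨁C ns) q x) (mult (⨁C ns) q y)
  ×-annihilates []       []             x y = tt
  ×-annihilates {q} (k ∷ ns) (k∣q ∷ ns∣q) x y = ×-⊕-≈ (C k) (⨁C ns) q x y
    (×-C-≈ k q (proj₁ x) (proj₁ y) (∣m⇒∣m*n (proj₁ x - proj₁ y) (∣ᵤ⇒∣ {+ k} {+ q} k∣q)))
    (×-annihilates ns ns∣q (proj₂ x) (proj₂ y))

  -- A difference divisible by `p` becomes divisible by `n = q p` once multiplied by `q`.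
  ×-replicate-≈ : ∀ {n q p} → n ≡ q ℕ.* p → ∀ r x y →
    (∀ l → + p ∣ coordC r x l - coordC r y l) →
    AbelianGroup._≈_ (⨁C (replicate r n)) (mult (⨁C (replicate r n)) q x) (mult (⨁C (replicate r n)) q y)
  ×-replicate-≈ n≡qp zero x y h = tt
  ×-replicate-≈ {n} {q} {p} refl (suc r) x y h = ×-⊕-≈ (C n) (⨁C (replicate r n)) q x y
    (×-C-≈ n q (proj₁ x) (proj₁ y) (subst (_∣ + q * (proj₁ x - proj₁ y)) (sym (ℤ.pos-* q p))
      (*-monoʳ-∣ (+ q) (h zero))))
    (×-replicate-≈ {q = q} refl r (proj₂ x) (proj₂ y) (h ∘ suc))

  module _ {c ℓ} (G : AbelianGroup c ℓ) {n r q p : ℕ} (ns : List ℕ) (n≡qp : n ≡ q ℕ.* p)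
           (ns∣q : All (ℕ._∣ q) ns) (iso : G ≅ ⨁C ns ⊕ ⨁C (replicate r n)) where

    private
      module G = AbelianGroup G
      K = ⨁C ns ⊕ ⨁C (replicate r n)
      module K = AbelianGroup K
      f = proj₁ iso
      open GroupMorphisms.IsGroupIsomorphism (proj₂ iso)

      f-× : ∀ w x → f (mult G w x) K.≈ mult K w (f x)
      f-× zero    x = ε-homo
      f-× (suc w) x = K.trans (∙-homo x (mult G w x)) (K.∙-congˡ (f-× w x))

      coordK : Fin r → K.Carrier → ℤ
      coordK l y = coordC r (proj₂ y) l

      coordK-cong : ∀ l x y → x K.≈ y → + n ∣ coordK l x - coordK l y
      coordK-cong l x y x≈y = coordC-cong r (proj₂ x) (proj₂ y) (proj₂ x≈y) l

    coordinates : Coordinates G n r q p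
    coordinates = record
      { coord = λ l x → coordK l (f x)
      ; coord-∙ = λ l x y → subst (λ s → + n ∣ coordK l (f (x G.∙ y)) - s)
          (coordC-∙ r (proj₂ (f x)) (proj₂ (f y)) l)
          (coordK-cong l (f (x G.∙ y)) (f x K.∙ f y) (∙-homo x y))
      ; coord-ε = λ l → subst (+ n ∣_)
          (trans (cong (λ s → coordK l (f G.ε) - s) (coordC-ε r l)) (ℤ.+-identityʳ _))
          (coordK-cong l (f G.ε) K.ε ε-homo)
      ; coord-cong = λ l {x} {y} x≈y → coordK-cong l (f x) (f y) (⟦⟧-cong x≈y)
      ; scale-≈ = λ x y h → injective (K.trans (f-× q x) (K.trans
          (×-⊕-≈ (⨁C ns) (⨁C (replicate r n)) q (f x) (f y)
            (×-annihilates ns ns∣q (proj₁ (f x)) (proj₁ (f y)))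
            (×-replicate-≈ {q = q} n≡qp r (proj₂ (f x)) (proj₂ (f y)) h))
          (K.sym (f-× q y))))
      ; basis = basis
      ; coord-basis = λ l i → subst (λ s → + n ∣ coordK l (f (basis i)) - s)
          (coordC-fromCoord r (λ l → δ l i) l)
          (coordK-cong l (f (basis i)) (e i) (proj₂ (surjective (e i)) G.refl))
      }
      where
      e : Fin r → K.Carrier
      e i = K.ε .proj₁ , fromCoord r (λ l → δ l i)

      basis : Fin r → G.Carrier
      basis i = proj₁ (surjective (e i))

  -- From relations modulo p to weighted zero-sums

  module Weighted {c ℓ} (G : AbelianGroup c ℓ) {n r q p : ℕ} (0<n : 1 ≤ n) (n≡qp : n ≡ q ℕ.* p)
                  (pr : Prime p) (coords : Coordinates G n r q p) where

    open AbelianGroup G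
      using (Carrier; _≈_; ε; rawMonoid; commutativeMonoid)
      renaming (sym to ≈-sym; trans to ≈-trans; reflexive to ≈-reflexive)
    open RawMonoidDefinitions rawMonoid using () renaming (_×_ to _·_; sum to sumᴳ)
    open Mult commutativeMonoid using (×-assocˡ; ×-congʳ)
    private module Σᴳ = CommutativeMonoidSum commutativeMonoid
    open Coordinates coords

    A = [ 1 , n ∸ 1 ]

    instance
      p≢0 : NonZero p
      p≢0 = prime⇒nonZero pr

      n≢0 : NonZero n
      n≢0 = ℕ.>-nonZero 0<n

      q≢0 : NonZero q
      q≢0 = ℕ.m*n≢0⇒m≢0 q {{subst NonZero n≡qp n≢0}}

    q<n : q ℕ.< n
    q<n = subst (q ℕ.<_) (sym n≡qp) (ℕ.m<m*n q p (ℕ.nonTrivial⇒n>1 p {{prime⇒nonTrivial pr}}))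

    p∣n : + p ∣ + n
    p∣n = divides (+ q) (trans (cong +_ n≡qp) (ℤ.pos-* q p))

    -- A nonzero residue gives a weight between `q` and `q (p - 1)`, hence in `A`; the factor `q`
    -- makes room for `scale-≈`.
    _-weight : ℤ → ℕ
    u -weight = q ℕ.* (u %ℕ p)

    weight∈A : ∀ u → ¬ (+ p ∣ u) → A (u -weight)
    weight∈A u p∤u = ℕ.*-mono-≤ (ℕ.>-nonZero⁻¹ q) (∤-%ℕ p u p∤u) , ℕ.<⇒≤pred
      (subst (u -weight ℕ.<_) (sym n≡qp) (ℕ.*-monoʳ-< q (n%ℕd<d u p)))

    ×-ε : ∀ w → w · ε ≈ ε
    -- The sum of the empty family is `ε`.
    ×-ε w = ×-sum G w {zero} (λ ())

    combination : ∀ {s} → Vector ℤ s → Vector Carrier s → Carrier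
    combination u g = sumᴳ (λ i → (u i %ℕ p) · g i)

    coord-combination : ∀ {s} (u : Vector ℤ s) (g : Vector Carrier s) l →
      + p ∣ coord l (combination u g) - sum (λ i → u i * coord l (g i))
    coord-combination u g l = subst (+ p ∣_) eq
      (∣m∣n⇒∣m+n (∣-trans p∣n (φ-combination G n (coord l) (coord-∙ l) (coord-ε l) (λ i → u i %ℕ p) g))
                 (∣-sum (λ i → (+ (u i %ℕ p) - u i) * coord l (g i))
                        (λ i → ∣m⇒∣m*n (coord l (g i)) (%ℕ-≡ p (u i)))))
      where
      W = λ i → + (u i %ℕ p) * coord l (g i)
      D = λ i → (+ (u i %ℕ p) - u i) * coord l (g i)
      U = λ i → u i * coord l (g i)

      split : ∀ w u x → w * x ≡ (w - u) * x + u * x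
      split = solve-∀

      cancel : ∀ a d u → (a - (d + u)) + d ≡ a - u
      cancel = solve-∀

      eq : (coord l (combination u g) - sum W) + sum D ≡ coord l (combination u g) - sum U
      eq = trans
        (cong (λ s → (coord l (combination u g) - s) + sum D)
          (trans (sum-cong-≗ (λ i → split (+ (u i %ℕ p)) (u i) (coord l (g i)))) (∑-distrib-+ D U)))
        (cancel (coord l (combination u g)) (sum D) (sum U))

    coord-× : ∀ u x l → + p ∣ coord l ((u %ℕ p) · x) - u * coord l x
    coord-× u x l = subst (+ p ∣_) (eq (coord l ((u %ℕ p) · x)) (+ (u %ℕ p)) u (coord l x))
      (∣m∣n⇒∣m+n (∣-trans p∣n (φ-× G n (coord l) (coord-∙ l) (coord-ε l) (u %ℕ p) x))
                 (∣m⇒∣m*n (coord l x) (%ℕ-≡ p u)))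
      where
      eq : ∀ a w u x → (a - w * x) + (w - u) * x ≡ a - u * x
      eq = solve-∀

    -- Off the support the residue is 0, so restricting the sum to the support loses nothing, and
    -- the factor `q` comes out.
    weightedSum-supp : ∀ {s} (u : Vector ℤ s) (g : Vector Carrier s) →
      weightedSum G g (supp p u) (_-weight ∘ u) ≈ q · combination u g
    weightedSum-supp u g = ≈-trans (Σᴳ.sum-cong-≋ term) (≈-sym (×-sum G q (λ i → (u i %ℕ p) · g i)))
      where
      term : ∀ i → (if lookup (supp p u) i then (u i -weight) · g i else ε) ≈ q · ((u i %ℕ p) · g i)
      term i with lookup (supp p u) i in eq
      ... | true  = ≈-sym (×-assocˡ (g i) q (u i %ℕ p))
      ... | false = ≈-sym (≈-trans (×-congʳ q (≈-reflexive (cong (_· g i) (∣-%ℕ p (u i) p∣ui)))) (×-ε q))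
        where
        p∣ui : + p ∣ u i
        p∣ui = decidable-stable (+ p ∣? u i)
          λ p∤ui → contradiction (trans (sym ([]=⇒lookup (∈supp⁺ p u p∤ui))) eq) λ ()

    weights-supp : ∀ {s} (u : Vector ℤ s) → Weights G A (supp p u) (_-weight ∘ u)
    weights-supp u i i∈ = weight∈A (u i) (∈supp⁻ p u i∈)

    -- All coordinates of the combination are divisible by `p`, so multiplication by `q` annihilates
    -- it.
    relation⇒zeroSum : ∀ {m} (S : Vector Carrier m) u → IsRelation p (λ x l → coord l (S x)) u →
                       ZeroSum G A S (supp p u)
    relation⇒zeroSum S u isRel = _-weight ∘ u , weights-supp u ,
      ≈-trans (weightedSum-supp u S) (≈-trans (scale-≈ (combination u S) ε h) (×-ε q))
      where
      cancel : ∀ a s e → ((a - s) + s) - e ≡ a - e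
      cancel = solve-∀

      h : ∀ l → + p ∣ coord l (combination u S) - coord l ε
      h l = subst (+ p ∣_) (cancel (coord l (combination u S)) _ (coord l ε))
        (∣m∣n⇒∣m-n (∣m∣n⇒∣m+n (coord-combination u S l) (isRel l)) (∣-trans p∣n (coord-ε l)))

    zeroSumFree⇒≤r : ∀ {m} (S : Vector Carrier m) T → ZeroSumFree G A S T → # T ≤ r
    zeroSumFree⇒≤r S T free = ℕ.≮⇒≥ λ r<∣T∣ →
      let u , isRel , u⊆T , nonempty = dependent pr (λ x l → coord l (S x)) T r<∣T∣
      in free (supp p u , u⊆T , nonempty , relation⇒zeroSum S u isRel)

    -- Otherwise `q · g` would vanish, although `q < n`.
    order⇒coord : ∀ {g} → IsOrder G g n → ¬ (∀ l → + p ∣ coord l g)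
    order⇒coord {g} (_ , _ , least) h = ℕ.<⇒≱ q<n (least q (ℕ.>-nonZero⁻¹ q)
      (≈-trans (scale-≈ g ε (λ l → ∣m∣n⇒∣m-n (h l) (∣-trans p∣n (coord-ε l)))) (×-ε q)))

    -- The sequence `basis` has length `r` and no nonempty zero-sum: coordinate `l` of one with
    -- `l ∈ I` would make `a l` a multiple of `n`, but it lies between 1 and `n - 1`.
    r<davenport : ∀ {D} → IsDavenportConstant G A D → r ℕ.< D
    r<davenport {D} (_ , P , _) = ℕ.≰⇒> λ D≤r → absurd (P r D≤r basis)
      where
      absurd : ¬ (∃[ I ] Nonempty I × ZeroSum G A basis I)
      absurd (I , (l , l∈I) , a , weights , sum≈ε) = ℕ.<⇒≱ al<n (ℕ.∣⇒≤ {{ℕ.>-nonZero 1≤al}} n∣al)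
        where
        1≤al = proj₁ (weights l l∈I)
        al<n : a l ℕ.< n
        al<n = subst (a l ℕ.<_) (ℕ.suc-pred n) (s≤s (proj₂ (weights l l∈I)))

        -- Weight 0 outside `I` turns the sum over `I` into a full combination, as `φ-combination`
        -- expects.
        a′ : Fin r → ℕ
        a′ i = if lookup I i then a i else 0

        term : ∀ i → (if lookup I i then a i · basis i else ε) ≡ a′ i · basis i
        term i with lookup I i
        ... | true  = refl
        ... | false = refl

        s : ℤ
        s = sum (λ i → + a′ i * coord l (basis i))

        n∣s : + n ∣ s
        n∣s = subst (+ n ∣_) (cancel (coord l (sumᴳ (λ i → a′ i · basis i))) s)
          (∣m∣n⇒∣m-n n∣x (φ-combination G n (coord l) (coord-∙ l) (coord-ε l) a′ basis))
          where
          cancel : ∀ x s → x - (x - s) ≡ s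
          cancel = solve-∀

          cancel′ : ∀ x e → (x - e) + e ≡ x
          cancel′ = solve-∀

          n∣x : + n ∣ coord l (sumᴳ (λ i → a′ i · basis i))
          n∣x = subst (+ n ∣_) (cancel′ _ (coord l ε)) (∣m∣n⇒∣m+n
            (coord-cong l (≈-trans (≈-sym (Σᴳ.sum-cong-≋ (λ i → ≈-reflexive (term i)))) sum≈ε))
            (coord-ε l))

        -- The coordinates of `basis i` are those of a unit vector only modulo `n`; `diff` collects
        -- the errors.
        diff : Vector ℤ r
        diff i = + a′ i * (coord l (basis i) - δ l i)

        a′l : Vector ℤ r
        a′l i = δ l i * + a′ i

        n∣a′l : + n ∣ + a′ l
        n∣a′l = subst (+ n ∣_) (trans (cancel (sum a′l) (sum diff)) (sum-δ l (+_ ∘ a′)))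
          (∣m∣n⇒∣m-n (subst (+ n ∣_) (trans (sum-cong-≗ (λ i → split (+ a′ i) (coord l (basis i)) (δ l i)))
                                            (∑-distrib-+ diff a′l)) n∣s)
                     (∣-sum diff (λ i → ∣n⇒∣m*n (+ a′ i) (coord-basis l i))))
          where
          cancel : ∀ a d → (d + a) - d ≡ a
          cancel = solve-∀

          split : ∀ a x d → a * x ≡ a * (x - d) + d * a
          split = solve-∀

        n∣al : n ℕ.∣ a l
        n∣al = subst (λ b → n ℕ.∣ (if b then a l else 0)) ([]=⇒lookup l∈I) (∣⇒∣ᵤ n∣a′l)

  -- The choice of p and the extremal structure

  primeDivisor : ∀ {e} → 2 ≤ e → ∃[ p ] Prime p × p ℕ.∣ e
  primeDivisor {e@(suc _)} 2≤e with factorise e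
  ... | record { factors = [] ; isFactorisation = eq } =
    contradiction (subst (2 ≤_) eq 2≤e) λ { (s≤s ()) }
  ... | record { factors = p ∷ ps ; isFactorisation = eq ; factorsPrime = pr ∷ _ } =
    p , pr , subst (p ℕ.∣_) (sym eq) (ℕ.m∣m*n _)

  -- In a divisibility chain the last entry is a multiple of all others. The value `d = 1` serves
  -- the trivial `H`.
  lastDivisor : ∀ {n} ns → 2 ≤ n → Linked ℕ._∣_ (ns ∷ʳ n) → All (ℕ._< n) ns →
                ∃[ d ] d ℕ.∣ n × d ℕ.< n × All (ℕ._∣ d) ns
  lastDivisor []            2≤n _               _          = 1 , ℕ.1∣ _ , 2≤n , []
  lastDivisor (d ∷ [])      2≤n (d∣n ∷ _)       (d<n ∷ []) = d , d∣n , d<n , ℕ.∣-refl ∷ []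
  lastDivisor (a ∷ b ∷ ns) 2≤n (a∣b ∷ linked) (_ ∷ <n)
    with lastDivisor (b ∷ ns) 2≤n linked <n
  ... | d , d∣n , d<n , b∣d ∷ ns∣d = d , d∣n , d<n , ℕ.∣-trans a∣b b∣d ∷ b∣d ∷ ns∣d

  -- As `d` is a proper divisor of `n`, the quotient `n / d` has a prime factor `p`, and `q = n / p`
  -- is still a multiple of `d`.
  cofactor : ∀ {n} ns → 2 ≤ n → Linked ℕ._∣_ (ns ∷ʳ n) → All (ℕ._< n) ns →
             ∃[ q ] ∃[ p ] n ≡ q ℕ.* p × Prime p × All (ℕ._∣ q) ns
  cofactor {n} ns 2≤n linked <n
    with d , ℕ.divides e n≡ed , d<n , ns∣d ← lastDivisor ns 2≤n linked <n
    with p , pr , ℕ.divides k e≡kp ← primeDivisor {e} (ℕ.≰⇒> λ e≤1 →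
           ℕ.<⇒≱ d<n (subst₂ _≤_ (sym n≡ed) (ℕ.*-identityˡ d) (ℕ.*-monoˡ-≤ d e≤1)))
    = k ℕ.* d , p , n≡ , pr , All.map (λ ∣d → ℕ.∣-trans ∣d (ℕ.n∣m*n k)) ns∣d
    where
    n≡ : n ≡ k ℕ.* d ℕ.* p
    n≡ = begin
      n                ≡⟨ n≡ed ⟩
      e ℕ.* d          ≡⟨ cong (ℕ._* d) e≡kp ⟩
      k ℕ.* p ℕ.* d    ≡⟨ ℕ.*-assoc k p d ⟩
      k ℕ.* (p ℕ.* d)  ≡⟨ cong (k ℕ.*_) (ℕ.*-comm p d) ⟩
      k ℕ.* (d ℕ.* p)  ≡⟨ ℕ.*-assoc k d p ⟨
      k ℕ.* d ℕ.* p    ∎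
      where open ≡-Reasoning

  -- The oddness of `n` enters here; it keeps `2 * (x * y)` nonzero modulo `p` in
  -- `supports-disjoint`.
  odd⇒∤2 : ∀ {n p} → Prime p → ¬ (2 ℕ.∣ n) → p ℕ.∣ n → ¬ (+ p ∣ + 2)
  odd⇒∤2 {n} {p} pr 2∤n p∣n p∣2 = 2∤n (subst (ℕ._∣ n) p≡2 p∣n)
    where
    p≡2 : p ≡ 2
    p≡2 = ℕ.≤-antisym (ℕ.∣⇒≤ (∣⇒∣ᵤ p∣2)) (ℕ.nonTrivial⇒n>1 p {{prime⇒nonTrivial pr}})

  -- Inserting the lower bound for `N` into the equality gives 2^(k + D) at most 2^(t + k + 1).
  2^-exponents : ∀ {N D t k} → N ℕ.* 2 ^ D ≡ 2 ^ suc (t ℕ.+ k) → 2 ^ k ≤ N → D ≤ suc t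
  2^-exponents {N} {D} {t} {k} eq 2^k≤N = ℕ.+-cancelˡ-≤ k D (suc t) (subst (k ℕ.+ D ≤_)
    (trans (cong suc (ℕ.+-comm t k)) (sym (ℕ.+-suc k t)))
    (ℕ.≮⇒≥ λ lt → ℕ.<⇒≱ (ℕ.^-monoʳ-< 2 ℕ.≤-refl lt) (begin
      2 ^ (k ℕ.+ D)      ≡⟨ ℕ.^-distribˡ-+-* 2 k D ⟩
      2 ^ k ℕ.* 2 ^ D    ≤⟨ ℕ.*-monoˡ-≤ (2 ^ D) 2^k≤N ⟩
      N ℕ.* 2 ^ D        ≡⟨ eq ⟩
      2 ^ suc (t ℕ.+ k)  ∎)))
    where open ℕ.≤-Reasoning

  2^-bound : ∀ {N D t k} → N ℕ.* 2 ^ D ≡ 2 ^ suc (t ℕ.+ k) → suc t ≤ D → N ≤ 2 ^ k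
  2^-bound {N} {D} {t} {k} eq t<D = ℕ.*-cancelʳ-≤ N (2 ^ k) (2 ^ D) {{ℕ.m^n≢0 2 D}} (begin
    N ℕ.* 2 ^ D        ≡⟨ eq ⟩
    2 ^ suc (t ℕ.+ k)  ≡⟨ cong (2 ^_) (ℕ.+-comm (suc t) k) ⟩
    2 ^ (k ℕ.+ suc t)  ≡⟨ ℕ.^-distribˡ-+-* 2 k (suc t) ⟩
    2 ^ k ℕ.* 2 ^ suc t ≤⟨ ℕ.*-monoʳ-≤ (2 ^ k) (ℕ.^-monoʳ-≤ 2 t<D) ⟩
    2 ^ k ℕ.* 2 ^ D    ∎)
    where open ℕ.≤-Reasoning

  -- Disjointness of the supports

  module Extremal {p} (pr : Prime p) (p∤2 : ¬ (+ p ∣ + 2)) {m r} {X : Fin m → Fin r → ℤ}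
                  (E : Elimination p X) where
    open Elimination E
    open Relations pr E

    rel-∣ : ∀ d → (∀ j → + p ∣ d j) → ∀ x → + p ∣ rel d x
    rel-∣ d h x with splitAt t (π ⟨$⟩ˡ x)
    ... | inj₁ i = ∣-sum (λ j → - d j * c j i) (λ j → ∣m⇒∣m*n (c j i) (∣m⇒∣-m (h j)))
    ... | inj₂ j = ∣m⇒∣m*n (b j) (h j)

    lift-empty : ∀ J → (∀ j → j ∉ₛ J) → ∀ x → x ∉ₛ lift J
    lift-empty J empty x x∈ = ∈supp⁻ p (rel (indicator J)) x∈ (rel-∣ (indicator J)
      (λ j → decidable-stable (+ p ∣? indicator J j)
        λ h → empty j (subst (j ∈ₛ_) (supp-indicator J) (∈supp⁺ p (indicator J) h))) x)

    -- y δ_j ± x δ_j′ have the same support, but only one of the two resulting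
    -- relations has a coefficient at i divisible by p when x = c j i and y = c j′ i.
    module _ (rel-supp : ∀ d d′ → supp p d ≡ supp p d′ → supp p (rel d) ≡ supp p (rel d′)) where

      pair : Fin k → Fin k → ℤ → ℤ → Vector ℤ k
      pair j j′ α β a = α * δ j a + β * δ j′ a

      -- As `j ≢ j′`, at most one of the two terms is nonzero at a given `a`, so flipping the sign
      -- of `β` changes the entry by a sign at most.
      pair-⊆ : ∀ {j j′} → j ≢ j′ → ∀ α β → supp p (pair j j′ α β) ⊆ supp p (pair j j′ α (- β))
      pair-⊆ {j} {j′} j≢j′ α β {a} a∈ = ∈supp⁺ p (pair j j′ α (- β))
        λ h → ∈supp⁻ p (pair j j′ α β) a∈ (flip-sign h)
        where
        flip₁ : ∀ x α β → α * x + - β * 0ℤ ≡ α * x + β * 0ℤ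
        flip₁ = solve-∀

        flip₂ : ∀ x α β → - (α * 0ℤ + - β * x) ≡ α * 0ℤ + β * x
        flip₂ = solve-∀

        flip-sign : + p ∣ α * δ j a + - β * δ j′ a → + p ∣ α * δ j a + β * δ j′ a
        flip-sign h with δ≡0⊎≡ j a | δ≡0⊎≡ j′ a
        ... | _         | inj₁ eq rewrite eq = subst (+ p ∣_) (flip₁ (δ j a) α β) h
        ... | inj₁ eq   | inj₂ _  rewrite eq = subst (+ p ∣_) (flip₂ (δ j′ a) α β) (∣m⇒∣-m h)
        ... | inj₂ j≡a  | inj₂ j′≡a = contradiction (trans j≡a (sym j′≡a)) j≢j′

      supp-pair : ∀ {j j′} → j ≢ j′ → ∀ α β → supp p (pair j j′ α β) ≡ supp p (pair j j′ α (- β))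
      supp-pair {j} {j′} j≢j′ α β = ⊆-antisym (pair-⊆ j≢j′ α β)
        (λ {a} a∈ → subst (λ γ → a ∈ₛ supp p (pair j j′ α γ)) (ℤ.neg-involutive β)
                          (pair-⊆ j≢j′ α (- β) a∈))

      innerPart-pair : ∀ j j′ α β i → innerPart (pair j j′ α β) i ≡ - α * c j i + - β * c j′ i
      innerPart-pair j j′ α β i = begin
        sum (λ a → - (α * δ j a + β * δ j′ a) * c a i)
          ≡⟨ sum-cong-≗ (λ a → expand (δ j a) (δ j′ a) α β (c a i)) ⟩
        sum (λ a → f a + f′ a)
          ≡⟨ ∑-distrib-+ f f′ ⟩
        sum f + sum f′
          ≡⟨ cong₂ _+_ (*-distribˡ-sum (- α) (λ a → δ j a * c a i))
                       (*-distribˡ-sum (- β) (λ a → δ j′ a * c a i)) ⟨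
        - α * sum (λ a → δ j a * c a i) + - β * sum (λ a → δ j′ a * c a i)
          ≡⟨ cong₂ (λ x y → - α * x + - β * y) (sum-δ j (λ a → c a i)) (sum-δ j′ (λ a → c a i)) ⟩
        - α * c j i + - β * c j′ i ∎
        where
        open ≡-Reasoning
        f f′ : Vector ℤ k
        f  a = - α * (δ j a * c a i)
        f′ a = - β * (δ j′ a * c a i)

        expand : ∀ x y α β c → - (α * x + β * y) * c ≡ - α * (x * c) + - β * (y * c)
        expand = solve-∀

      supports-disjoint : ∀ j j′ → j ≢ j′ → Empty (supp p (c j) ∩ supp p (c j′))
      supports-disjoint j j′ j≢j′ (i , i∈) with x∈p∩q⁻ (supp p (c j)) (supp p (c j′)) i∈
      ... | i∈j , i∈j′ = ∈supp⁻ p (rel d)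
          (subst (inner i ∈ₛ_) (sym (rel-supp d d′ (supp-pair j≢j′ y (- x)))) (∈supp⁺ p (rel d′) ∤rel))
          (subst (+ p ∣_) (sym (trans (rel-inner d i) (trans (innerPart-pair j j′ y (- x) i) (eq x y))))
                 (divides 0ℤ refl))
        where
        x = c j i
        y = c j′ i
        d  = pair j j′ y (- x)
        d′ = pair j j′ y (- (- x))

        eq : ∀ x y → - y * x + - (- x) * y ≡ 0ℤ
        eq = solve-∀

        eq′ : ∀ x y → - (- y * x + - (- (- x)) * y) ≡ + 2 * (x * y)
        eq′ = solve-∀

        ∤rel : ¬ (+ p ∣ rel d′ (inner i))
        ∤rel h = [ p∤2 , (λ h′ → [ ∈supp⁻ p (c j) i∈j , ∈supp⁻ p (c j′) i∈j′ ]′ (prime∣* pr x y h′)) ]′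
          (prime∣* pr (+ 2) (x * y) (subst (+ p ∣_)
            (trans (cong -_ (trans (rel-inner d′ i) (innerPart-pair j j′ y (- (- x)) i))) (eq′ x y))
            (∣m⇒∣-m h)))

  -- Structure of the sequence in the case of equality

  module Structure {c ℓ} (G : AbelianGroup c ℓ) {n r q p : ℕ} (0<n : 1 ≤ n)
      (n≡qp : n ≡ q ℕ.* p) (pr : Prime p) (p∤2 : ¬ (+ p ∣ + 2)) (coords : Coordinates G n r q p)
      {m} (S : Vector (AbelianGroup.Carrier G) m) (order : ∀ i → IsOrder G (S i) n)
      {D N} (dav : IsDavenportConstant G [ 1 , n ∸ 1 ] D) (isN₀ : IsN₀ G [ 1 , n ∸ 1 ] S N)
      (N*2^D : N ℕ.* 2 ^ D ≡ 2 ^ suc m) where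

    open AbelianGroup G using (rawMonoid; commutativeMonoid)
      renaming (sym to ≈-sym; trans to ≈-trans)
    open RawMonoidDefinitions rawMonoid using () renaming (_×_ to _·_)
    open Mult commutativeMonoid using (×-assocˡ)
    open Coordinates coords
    open Weighted G 0<n n≡qp pr coords

    X : Fin m → Fin r → ℤ
    X x l = coord l (S x)

    E : Elimination p X
    E = eliminate pr r X

    open Elimination E renaming (c to coeff)
    open Relations pr E
    open Extremal pr p∤2 E

    private
      t+k≡m : t ℕ.+ k ≡ m
      t+k≡m = ↔⇒≡ π

      N*2^D′ : N ℕ.* 2 ^ D ≡ 2 ^ suc (t ℕ.+ k)
      N*2^D′ = trans N*2^D (cong (λ m → 2 ^ suc m) (sym t+k≡m))

      rel-zeroSum : ∀ d → ZeroSum G A S (supp p (rel d))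
      rel-zeroSum d = relation⇒zeroSum S (rel d) (rel-isRelation d)

      lift-zeroSum : ∀ J → ZeroSum G A S (lift J)
      lift-zeroSum J = rel-zeroSum (indicator J)

    -- The 2^k lifted zero-sums force `D ≤ t + 1`, whereas `r + 1 ≤ D`.
    t≡r : t ≡ r
    t≡r = ℕ.≤-antisym t≤r (ℕ.≤-pred (ℕ.≤-trans (r<davenport dav)
      (2^-exponents {N} {D} N*2^D′ (section⇒2^k≤N isN₀ lift (preimage outer) preimage-lift lift-zeroSum))))

    -- Now N is at most 2^k, so the lifts of the 2^k outer sets are all the zero-sum index sets.
    zeroSum-unique : ∀ I → ZeroSum G A S I → I ≡ lift (preimage outer I)
    zeroSum-unique = section⇒surjective isN₀ lift (preimage outer) preimage-lift lift-zeroSum _≟ₛ_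
      (2^-bound {N} {D} {t} N*2^D′ (subst (λ t → suc t ≤ D) (sym t≡r) (r<davenport dav)))

    rel-supp : ∀ d d′ → supp p d ≡ supp p d′ → supp p (rel d) ≡ supp p (rel d′)
    rel-supp d d′ eq = trans (unique d) (trans (cong lift eq) (sym (unique d′)))
      where
      unique : ∀ d → supp p (rel d) ≡ lift (supp p d)
      unique d = trans (zeroSum-unique _ (rel-zeroSum d)) (cong lift (preimage-supp-rel d))

    T : Subset m
    T = tabulate (λ x → [ const true , const false ]′ (splitAt t (π ⟨$⟩ˡ x)))

    inner∈T : ∀ i → inner i ∈ₛ T
    inner∈T i = ∈-tabulate⁺ (cong [ const true , const false ]′
      (trans (cong (splitAt t) (inverseˡ π)) (splitAt-↑ˡ t i k)))

    outer∉T : ∀ j → outer j ∉ₛ T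
    outer∉T j j∈ with () ← trans (sym (∈-tabulate⁻ j∈)) (cong [ const true , const false ]′
      (trans (cong (splitAt t) (inverseˡ π)) (splitAt-↑ʳ t k j)))

    -- A zero-sum inside `T` has empty outer part, hence it is the lift of the empty set, which is
    -- empty.
    T-zeroSumFree : ZeroSumFree G A S T
    T-zeroSumFree (I , I⊆T , (x , x∈I) , zs) = lift-empty (preimage outer I)
      (λ j j∈ → outer∉T j (I⊆T (∈-preimage⁻ outer j∈))) x
      (subst (x ∈ₛ_) (zeroSum-unique I zs) x∈I)

    T-maximal : IsMaximalZeroSumFree G A S T
    T-maximal = T-zeroSumFree , λ T′ free → begin
      # T′  ≤⟨ zeroSumFree⇒≤r S T′ free ⟩
      r     ≡⟨ t≡r ⟨
      t     ≤⟨ injective⇒≤∣∣ T inner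
                 (λ {i} {j} eq → ↑ˡ-injective k i j (Injection.injective (↔⇒↣ π) eq)) inner∈T ⟩
      # T   ∎
      where open ℕ.≤-Reasoning

    J : Fin k → Subset t
    J j = supp p (coeff j)

    J-disjoint : ∀ i j → i ≢ j → Empty (J i ∩ J j)
    J-disjoint = supports-disjoint rel-supp

    -- If `p` divided all `coeff j i`, it would divide `b j` times the coordinates of the term at
    -- `outer j`, hence these coordinates, against its order `n`.
    J-nonempty : ∀ j → Nonempty (J j)
    J-nonempty j with any? (λ i → ¬? (+ p ∣? coeff j i))
    ... | yes (i , h) = i , ∈supp⁺ p (coeff j) h
    ... | no none = contradiction p∣X (order⇒coord (order (outer j)))
      where
      cancel : ∀ a s → (a - s) + s ≡ a
      cancel = solve-∀

      p∣X : ∀ l → + p ∣ X (outer j) l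
      p∣X l = [ (λ h → contradiction h (p∤b j)) , (λ h → h) ]′ (prime∣* pr (b j) (X (outer j) l)
        (subst (+ p ∣_) (cancel (b j * X (outer j) l) _)
          (∣m∣n⇒∣m+n (relation j l) (∣-sum (λ i → coeff j i * X (inner i) l)
            (λ i → ∣m⇒∣m*n (X (inner i) l)
              (decidable-stable (+ p ∣? coeff j i) (λ h → none (i , h))))))))

    -- Picking one element from each of the nonempty disjoint sets `J j` is injective.
    k≤t : k ≤ t
    k≤t = injective⇒≤ {f = λ j → proj₁ (J-nonempty j)} λ {i} {j} eq →
      decidable-stable (i ≟ j) λ i≢j → J-disjoint i j i≢j
        (_ , x∈p∩q⁺ (proj₂ (J-nonempty i) , subst (_∈ₛ J j) (sym eq) (proj₂ (J-nonempty j))))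

    splits : Splits G A S T t k
    splits = record
      { π = π ; g∈T = inner∈T ; h∉T = outer∉T ; J = J ; disjoint = J-disjoint
      ; relation = λ j → b j -weight , _-weight ∘ coeff j ,
          weight∈A (b j) (p∤b j) , weights-supp (coeff j) ,
          ≈-trans (≈-sym (×-assocˡ (S (outer j)) q (b j %ℕ p)))
            -- The relation given by elimination holds for coordinates modulo `p`; multiplied by `q`
            -- it becomes an identity in `G`.
            (≈-trans (scale-≈ _ _ (congruent j))
                     (≈-sym (weightedSum-supp (coeff j) (S ∘ inner)))) }
      where
      eq : ∀ a b x s c → ((a - b * x) + (b * x - s)) - (c - s) ≡ a - c
      eq = solve-∀

      congruent : ∀ j l → + p ∣ coord l ((b j %ℕ p) · S (outer j)) -
                                coord l (combination (coeff j) (S ∘ inner))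
      congruent j l = subst (+ p ∣_) (eq (coord l ((b j %ℕ p) · S (outer j))) (b j) (X (outer j) l) _
            (coord l (combination (coeff j) (S ∘ inner))))
        (∣m∣n⇒∣m-n (∣m∣n⇒∣m+n (coord-× (b j) (S (outer j)) l) (relation j l))
                   (coord-combination (coeff j) (S ∘ inner) l))

    conclusion : r ≤ m × m ≤ 2 ℕ.* r ×
      (∃[ T ] IsMaximalZeroSumFree G A S T × (∃[ k ] k ≤ r × Splits G A S T r k))
    -- Everything is built with `t` and carried over along `t≡r`. The upper bound comes from
    -- `m = t + k` and `k ≤ t`.
    conclusion = subst (λ r → r ≤ m × m ≤ 2 ℕ.* r ×
        (∃[ T ] IsMaximalZeroSumFree G A S T × (∃[ k ] k ≤ r × Splits G A S T r k))) t≡r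
      ( subst (t ≤_) t+k≡m (ℕ.m≤m+n t k)
      , subst₂ _≤_ t+k≡m (cong (t ℕ.+_) (sym (ℕ.+-identityʳ t))) (ℕ.+-monoʳ-≤ t k≤t)
      , T , T-maximal , k , k≤t , splits)

open import Data.Nat.Base using (_*_)
open import Data.Nat.Divisibility using (_∣_)

-- The value 2^(m - D + 1) of `N` is expressed after multiplication by `2 ^ D`, because subtraction
-- on `ℕ` is truncated.
theorem4p2 : ∀ {c ℓ} (G : AbelianGroup c ℓ) (let open AbelianGroup G)
    (n r : ℕ) (ns : List ℕ) →
    2 ≤ n → ¬ (2 ∣ n) → IsExponent G n →
    All (1 <_) ns → Linked _∣_ (ns ∷ʳ n) → All (_< n) ns →
    G ≅ ⨁C ns ⊕ ⨁C (replicate r n) →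
    (m : ℕ) (S : Vector Carrier m) →
    (∀ i → ¬ (S i ≈ ε)) →
    (∀ i → IsOrder G (S i) n) →
    (D N : ℕ) →
    IsDavenportConstant G [ 1 , n ∸ 1 ] D →
    IsN₀ G [ 1 , n ∸ 1 ] S N →
    N * 2 ^ D ≡ 2 ^ suc m →
    r ≤ m × m ≤ 2 * r ×
    (∃[ T ] IsMaximalZeroSumFree G [ 1 , n ∸ 1 ] S T ×
    (∃[ k ] k ≤ r × Splits G [ 1 , n ∸ 1 ] S T r k))
theorem4p2 G n r ns 2≤n 2∤n _ _ linked ns<n iso m S _ order D N dav isN₀ N*2^D
  with q , p , n≡qp , pr , ns∣q ← cofactor ns 2≤n linked ns<n
  = Structure.conclusion G (ℕ.<⇒≤ 2≤n) n≡qp pr (odd⇒∤2 pr 2∤n (ℕ.divides q n≡qp))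
      (coordinates G ns n≡qp ns∣q iso) S order dav isN₀ N*2^D
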